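{- Let $N\ge 1$, $w\in\mathbb{R}^N$, $\gamma\in\mathbb{R}$, and let $$V(z)=\sum_{1\le i\le j\le N} Q_{ij}z_iz_j+\sum_{i=1}^N d_i z_i+\mathrm{const}$$ be a quadratic polynomial with integer coefficients $Q_{ij},d_i\in\mathbb{Z}$. Let $\mathcal{C}:=\{i\in\{1,\dots,N\}: w_i\neq 0\}$ be the set of core indices, and assume $V$ is diagonal-free on the core variables, i.e. $Q_{ii}=0$ for all $i\in\mathcal{C}$. Let $\hat f(z)=w^\top z+\gamma V(z)$ for $z\in[0,1]^N$. Assume $$|\gamma|>\max_{i\in\mathcal{C}}|w_i|.$$ Then every local minimizer $z^\star$ of $\hat f$ over $[0,1]^N$ satisfies $z^\star_i\in\{0,1\}$ for all $i\in\mathcal{C}$.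
   Context: A local minimizer of $\hat f$ over $[0,1]^N$ is a point $z^\star\in[0,1]^N$ such that $\hat f(z^\star)\le\hat f(z)$ for all $z\in[0,1]^N$ in some neighborhood of $z^\star$. -}

module Defs where

open import Level using (Level; suc; _⊔_)
open import Algebra.Bundles using (CommutativeRing)
open import Algebra.Core using (Op₁; Op₂)
open import Algebra.Structures using (IsCommutativeRing)
import Algebra.Construct.NaturalChoice.Max as Max
import Algebra.Definitions.RawMonoid as RawMonoidDefinitions
import Data.List.Extrema as Extrema
open import Data.Bool.Base using (if_then_else_)
open import Data.Fin.Base using (Fin)
import Data.Fin.Properties as Fin
open import Data.Integer.Base using (ℤ; +_; -[1+_])
open import Data.List.Base using (List; map; filter; allFin)
open import Data.Nat.Base as ℕ using (ℕ)
open import Data.Product.Base using (∃; _×_)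
open import Data.Vec.Functional using (Vector)
open import Relation.Binary.Bundles using (DecTotalOrder)
open import Relation.Binary.Core using (Rel)
import Relation.Binary.Properties.DecTotalOrder as DecTotalOrderProperties
open import Relation.Binary.Structures using (IsDecTotalOrder)
open import Relation.Nullary.Decidable using (does; ¬?)
open import Relation.Nullary.Negation using (¬_)
open import Relation.Unary using (Pred; Decidable)

-- The classical real numbers, axiomatised as a Dedekind-complete ordered
-- field (unique up to isomorphism in classical mathematics). The order is
-- decidable, as it is classically; this and `supremum` are the only classical
-- ingredients.

record CompleteOrderedField (c ℓ₁ ℓ₂ : Level) : Set (suc (c ⊔ ℓ₁ ⊔ ℓ₂)) where
  infix  8 -_
  infixl 7 _*_
  infixl 6 _+_
  infix  4 _≈_ _≤_
  field
    Carrier           : Set c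
    _≈_               : Rel Carrier ℓ₁
    _≤_               : Rel Carrier ℓ₂
    _+_ _*_           : Op₂ Carrier
    -_                : Op₁ Carrier
    0# 1#             : Carrier
    isCommutativeRing : IsCommutativeRing _≈_ _+_ _*_ -_ 0# 1#
    0≉1               : ¬ (0# ≈ 1#)
    inverse           : ∀ x → ¬ (x ≈ 0#) → ∃ λ y → x * y ≈ 1#
    isDecTotalOrder   : IsDecTotalOrder _≈_ _≤_
    +-monoˡ-≤         : ∀ z {x y} → x ≤ y → x + z ≤ y + z
    *-nonNeg          : ∀ {x y} → 0# ≤ x → 0# ≤ y → 0# ≤ x * y

  UpperBound : ∀ {p} → Pred Carrier p → Pred Carrier (c ⊔ ℓ₂ ⊔ p)
  UpperBound P u = ∀ x → P x → x ≤ u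

  field
    supremum : (P : Pred Carrier (c ⊔ ℓ₁ ⊔ ℓ₂)) → ∃ P → ∃ (UpperBound P) →
               ∃ λ s → UpperBound P s × (∀ u → UpperBound P u → s ≤ u)

  commutativeRing : CommutativeRing c ℓ₁
  commutativeRing = record { isCommutativeRing = isCommutativeRing }

  decTotalOrder : DecTotalOrder c ℓ₁ ℓ₂
  decTotalOrder = record { isDecTotalOrder = isDecTotalOrder }

  open CommutativeRing commutativeRing public using (_-_; +-rawMonoid)
  open DecTotalOrder decTotalOrder public using (_≟_; totalOrder)
  open DecTotalOrderProperties decTotalOrder public using (_<_)

module Optimization {c ℓ₁ ℓ₂} (ℝ : CompleteOrderedField c ℓ₁ ℓ₂) where
  open CompleteOrderedField ℝ
  open RawMonoidDefinitions +-rawMonoid using (sum) renaming (_×_ to _×ᴺ_)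

  ∣_∣ : Op₁ Carrier
  ∣ x ∣ = Max._⊔_ totalOrder x (- x)

  fromℤ : ℤ → Carrier
  fromℤ (+ n)    = n ×ᴺ 1#
  fromℤ -[1+ n ] = - (ℕ.suc n ×ᴺ 1#)

  Cube : ∀ {N} → Pred (Vector Carrier N) ℓ₂
  Cube z = ∀ i → 0# ≤ z i × z i ≤ 1#

  -- The open sup-norm balls are a neighbourhood basis of ℝᴺ.
  Near : ∀ {N} → Carrier → Vector Carrier N → Vector Carrier N → Set (ℓ₁ ⊔ ℓ₂)
  Near ε z₀ z = ∀ i → ∣ z i - z₀ i ∣ < ε

  LocalMinimizer : ∀ {N} → (Vector Carrier N → Carrier) →
                   Pred (Vector Carrier N) (c ⊔ ℓ₁ ⊔ ℓ₂)
  LocalMinimizer f z* =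
    Cube z* ×
    ∃ λ ε → 0# < ε × (∀ z → Cube z → Near ε z* z → f z* ≤ f z)

  -- Only the entries Q i j with i ≤ j occur.
  quadratic : ∀ {N} → (Fin N → Fin N → ℤ) → Vector ℤ N → Carrier →
              Vector Carrier N → Carrier
  quadratic Q d const z =
      sum (λ i → sum (λ j →
        if does (i Fin.≤? j) then fromℤ (Q i j) * (z i * z j) else 0#))
    + sum (λ i → fromℤ (d i) * z i)
    + const

  Core : ∀ {N} → Vector Carrier N → Pred (Fin N) ℓ₁
  Core w i = ¬ (w i ≈ 0#)

  core? : ∀ {N} (w : Vector Carrier N) → Decidable (Core w)
  core? w i = ¬? (w i ≟ 0#)

  coreIndices : ∀ {N} → Vector Carrier N → List (Fin N)
  coreIndices {N} w = filter (core? w) (allFin N)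

  -- The first argument of `max` is its value on the empty list, so the
  -- maximum over an empty core is 0; otherwise 0 ≤ ∣ w i ∣ makes it irrelevant.
  maxCoreWeight : ∀ {N} → Vector Carrier N → Carrier
  maxCoreWeight w = Extrema.max totalOrder 0# (map (λ i → ∣ w i ∣) (coreIndices w))

  objective : ∀ {N} → Vector Carrier N → Carrier → (Vector Carrier N → Carrier) →
              Vector Carrier N → Carrier
  objective w γ V z = sum (λ i → w i * z i) + γ * V z

{-# OPTIONS --safe #-}

-- Suppose 0 < z*ᵢ < 1 for a core index i. The objective f has no zᵢ² term, so
-- moving zᵢ alone shows ∂ᵢf(z*) = 0. Moving zᵢ and another fractional zⱼ
-- together shows that the mixed coefficient of zᵢzⱼ vanishes: the Hessian
-- restricted to the fractional coordinates is positive semidefinite, and a zero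
-- on its diagonal forces a zero row. Hence in ∂ᵢf(z*) = wᵢ + γ m only the
-- coordinates zⱼ ∈ {0,1} contribute to m, so m is an integer. If m = 0 then
-- wᵢ = 0, and otherwise |γ| ≤ |γ m| = |wᵢ|; both are excluded.

module Submission where

open import Defs
open import Algebra.Bundles using (CommutativeRing)
import Algebra.Construct.NaturalChoice.Max as Max
import Algebra.Properties.Monoid.Mult as MonoidMult
import Algebra.Properties.Ring as RingProperties
import Algebra.Properties.Semiring.Sum as SemiringSum
import Algebra.Solver.Ring.NaturalCoefficients.Default as SemiringSolver
open import Data.Bool.Base using (true; false; if_then_else_)
open import Data.Empty using (⊥; ⊥-elim)
open import Data.Fin.Base using (Fin; zero; suc)
import Data.Fin.Properties as Fin
open import Data.Integer.Base using (ℤ; 0ℤ; +_; -[1+_])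
import Data.List.Extrema as Extrema
import Data.List.Relation.Unary.All as All
open import Data.List.Membership.Propositional.Properties
  using (∈-map⁺; ∈-filter⁺; ∈-allFin)
open import Data.Nat.Base as ℕ using (ℕ; _≥_)
open import Data.Product.Base using (∃; ∃₂; _×_; _,_; proj₁; proj₂)
open import Data.Sum.Base using (_⊎_; inj₁; inj₂)
open import Data.Vec.Functional using (Vector; updateAt; tail)
open import Data.Vec.Functional.Properties
  using (updateAt-updates; updateAt-minimal)
open import Function.Base using (_∘_; case_of_)
open import Relation.Binary.Bundles using (DecTotalOrder)
open import Relation.Binary.PropositionalEquality as ≡ using (_≡_; _≢_)
open import Relation.Nullary.Decidable using (does; yes; no)
open import Relation.Nullary.Negation using (¬_; contradiction)

-- Ordered field arithmetic, and inequalities that force a coefficient to vanish.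

module OrderedFieldProperties {c ℓ₁ ℓ₂} (ℝ : CompleteOrderedField c ℓ₁ ℓ₂) where
  open CompleteOrderedField ℝ
  open Optimization ℝ using (∣_∣)
  open CommutativeRing commutativeRing
    hiding (Carrier; _≈_; _+_; _*_; -_; 0#; 1#; _-_; +-rawMonoid; isCommutativeRing; zero)
  open DecTotalOrder decTotalOrder using (poset; total; antisym)
    renaming (refl to ≤-refl; reflexive to ≤-reflexive; trans to ≤-trans;
              ≤-respʳ-≈ to ≤-respʳ; ≤-respˡ-≈ to ≤-respˡ)
  open RingProperties ring
    using (-‿distribˡ-*; -‿distribʳ-*; -‿involutive; -‿anti-homo-+; x+x≈x⇒x≈0;
           //-rightDividesˡ; //-rightDividesʳ)
  open SemiringSolver commutativeSemiring using (solve; _:+_; _:*_; _:=_)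
  open import Relation.Binary.Reasoning.PartialOrder poset

  +-mono-≤ : ∀ {x y u v} → x ≤ y → u ≤ v → x + u ≤ y + v
  +-mono-≤ {x} {y} {u} {v} x≤y u≤v = begin
    x + u  ≤⟨ +-monoˡ-≤ u x≤y ⟩
    y + u  ≈⟨ +-comm y u ⟩
    u + y  ≤⟨ +-monoˡ-≤ y u≤v ⟩
    v + y  ≈⟨ +-comm v y ⟩
    y + v  ∎

  +-cancelʳ-≤ : ∀ z {x y} → x + z ≤ y + z → x ≤ y
  +-cancelʳ-≤ z {x} {y} h = begin
    x          ≈⟨ //-rightDividesʳ z x ⟨
    x + z - z  ≤⟨ +-monoˡ-≤ (- z) h ⟩
    y + z - z  ≈⟨ //-rightDividesʳ z y ⟩
    y          ∎

  x≤y⇒0≤y-x : ∀ {x y} → x ≤ y → 0# ≤ y - x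
  x≤y⇒0≤y-x {x} {y} x≤y = ≤-respˡ (-‿inverseʳ x) (+-monoˡ-≤ (- x) x≤y)

  0≤y-x⇒x≤y : ∀ {x y} → 0# ≤ y - x → x ≤ y
  0≤y-x⇒x≤y {x} {y} h = begin
    x           ≈⟨ +-identityˡ x ⟨
    0# + x      ≤⟨ +-monoˡ-≤ x h ⟩
    y - x + x   ≈⟨ //-rightDividesˡ x y ⟩
    y           ∎

  x≤x+y : ∀ {x y} → 0# ≤ y → x ≤ x + y
  x≤x+y {x} 0≤y = ≤-respˡ (+-identityʳ x) (+-mono-≤ ≤-refl 0≤y)

  x≤x+y⇒0≤y : ∀ {x y} → x ≤ x + y → 0# ≤ y
  x≤x+y⇒0≤y {x} {y} h = +-cancelʳ-≤ x (≤-respˡ (sym (+-identityˡ x)) (≤-respʳ (+-comm x y) h))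

  0≤x⇒-x≤0 : ∀ {x} → 0# ≤ x → - x ≤ 0#
  0≤x⇒-x≤0 {x} 0≤x = 0≤y-x⇒x≤y (≤-respʳ (sym (trans (+-identityˡ _) (-‿involutive x))) 0≤x)

  x≤0⇒0≤-x : ∀ {x} → x ≤ 0# → 0# ≤ - x
  x≤0⇒0≤-x {x} x≤0 = ≤-respʳ (+-identityˡ (- x)) (x≤y⇒0≤y-x x≤0)

  0≤-x⇒x≤0 : ∀ {x} → 0# ≤ - x → x ≤ 0#
  0≤-x⇒x≤0 {x} 0≤-x = 0≤y-x⇒x≤y (≤-respʳ (sym (+-identityˡ (- x))) 0≤-x)

  *-monoʳ-≤ : ∀ {z x y} → 0# ≤ z → x ≤ y → z * x ≤ z * y
  *-monoʳ-≤ {z} {x} {y} 0≤z x≤y = 0≤y-x⇒x≤y (≤-respʳ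
    (trans (distribˡ z y (- x)) (+-congˡ (sym (-‿distribʳ-* z x))))
    (*-nonNeg 0≤z (x≤y⇒0≤y-x x≤y)))

  -x*-y≈x*y : ∀ x y → - x * - y ≈ x * y
  -x*-y≈x*y x y = trans (sym (-‿distribˡ-* x (- y)))
    (trans (-‿cong (sym (-‿distribʳ-* x y))) (-‿involutive (x * y)))

  -- If `1# ≤ 0#`, then `- 1#` is nonnegative, and so is its square, which is `1#`.
  0≤1 : 0# ≤ 1#
  0≤1 with total 0# 1#
  ... | inj₁ 0≤1′ = 0≤1′
  ... | inj₂ 1≤0  = ≤-respʳ (trans (-x*-y≈x*y 1# 1#) (*-identityˡ 1#))
                      (*-nonNeg (x≤0⇒0≤-x 1≤0) (x≤0⇒0≤-x 1≤0))

  0<1 : 0# < 1#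
  0<1 = 0≤1 , 0≉1

  x≉0⇒x*y≈0⇒y≈0 : ∀ {x y} → ¬ x ≈ 0# → x * y ≈ 0# → y ≈ 0#
  x≉0⇒x*y≈0⇒y≈0 {x} {y} x≉0 xy≈0 with inverse x x≉0
  ... | x⁻¹ , x*x⁻¹≈1 = begin-equality
    y              ≈⟨ *-identityˡ y ⟨
    1# * y         ≈⟨ *-congʳ x*x⁻¹≈1 ⟨
    x * x⁻¹ * y    ≈⟨ solve 3 (λ a b d → a :* b :* d := b :* (a :* d)) refl x x⁻¹ y ⟩
    x⁻¹ * (x * y)  ≈⟨ *-congˡ xy≈0 ⟩
    x⁻¹ * 0#       ≈⟨ zeroʳ x⁻¹ ⟩
    0#             ∎

  <⇒≉0 : ∀ {x} → 0# < x → ¬ x ≈ 0#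
  <⇒≉0 (_ , 0≉x) x≈0 = 0≉x (sym x≈0)

  *-pos : ∀ {x y} → 0# < x → 0# < y → 0# < x * y
  *-pos 0<x 0<y = *-nonNeg (proj₁ 0<x) (proj₁ 0<y) ,
    λ 0≈xy → <⇒≉0 0<y (x≉0⇒x*y≈0⇒y≈0 (<⇒≉0 0<x) (sym 0≈xy))

  -- When `y ≤ 0#` the product is nonpositive as well as nonnegative, hence zero, and then `y` is
  -- zero because `x` is not.
  *-cancelˡ-nonNeg : ∀ {x y} → 0# < x → 0# ≤ x * y → 0# ≤ y
  *-cancelˡ-nonNeg {x} {y} 0<x 0≤xy with total 0# y
  ... | inj₁ 0≤y = 0≤y
  ... | inj₂ y≤0 = ≤-reflexive (sym (x≉0⇒x*y≈0⇒y≈0 (<⇒≉0 0<x)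
    (antisym (≤-respʳ (zeroʳ x) (*-monoʳ-≤ (proj₁ 0<x) y≤0)) 0≤xy)))

  inverse-pos : ∀ {x y} → 0# < x → x * y ≈ 1# → 0# < y
  inverse-pos {x} 0<x xy≈1 = *-cancelˡ-nonNeg 0<x (≤-respʳ (sym xy≈1) 0≤1) ,
    λ 0≈y → 0≉1 (trans (sym (zeroʳ x)) (trans (*-congˡ 0≈y) xy≈1))

  ≤-<-trans : ∀ {x y z} → x ≤ y → y < z → x < z
  ≤-<-trans x≤y (y≤z , y≉z) = ≤-trans x≤y y≤z ,
    λ x≈z → y≉z (antisym y≤z (≤-respˡ x≈z x≤y))

  <⇒≱ : ∀ {x y} → x < y → ¬ y ≤ x
  <⇒≱ (x≤y , x≉y) y≤x = x≉y (antisym x≤y y≤x)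

  0≤x+x⇒0≤x : ∀ {x} → 0# ≤ x + x → 0# ≤ x
  0≤x+x⇒0≤x {x} h with total 0# x
  ... | inj₁ 0≤x = 0≤x
  ... | inj₂ x≤0 = ≤-trans h (≤-respʳ (+-identityʳ x) (+-mono-≤ ≤-refl x≤0))

  0<2 : 0# < 1# + 1#
  0<2 = ≤-trans 0≤1 (x≤x+y 0≤1) ,
    λ 0≈2 → 0≉1 (antisym 0≤1 (≤-respʳ (sym 0≈2) (x≤x+y 0≤1)))

  -- The witness is half of `x`. It serves to pass from weak bounds on a step to the strict bound
  -- that `Near` demands.
  positive-below : ∀ {x} → 0# < x → ∃ λ y → 0# < y × y < x
  positive-below {x} 0<x with inverse (1# + 1#) (<⇒≉0 0<2)
  ... | h , 2h≈1 = y , 0<y , ≤-respʳ y+y≈x (x≤x+y (proj₁ 0<y)) ,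
    λ y≈x → <⇒≉0 0<y (x+x≈x⇒x≈0 y (trans y+y≈x (sym y≈x)))
    where
    y = x * h
    0<y = *-pos 0<x (inverse-pos 0<2 2h≈1)
    y+y≈x : y + y ≈ x
    y+y≈x = begin-equality
      x * h + x * h      ≈⟨ distribˡ x h h ⟨
      x * (h + h)        ≈⟨ *-congˡ (+-cong (*-identityˡ h) (*-identityˡ h)) ⟨
      x * (1# * h + 1# * h)  ≈⟨ *-congˡ (distribʳ h 1# 1#) ⟨
      x * ((1# + 1#) * h)  ≈⟨ *-congˡ 2h≈1 ⟩
      x * 1#             ≈⟨ *-identityʳ x ⟩
      x                  ∎

  min-pos : ∀ {x y} → 0# < x → 0# < y → ∃ λ z → 0# < z × z ≤ x × z ≤ y
  min-pos {x} {y} 0<x 0<y with total x y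
  ... | inj₁ x≤y = x , 0<x , ≤-refl , x≤y
  ... | inj₂ y≤x = y , 0<y , y≤x , ≤-refl

  x≤∣x∣ : ∀ x → x ≤ ∣ x ∣
  x≤∣x∣ x = Max.x≤x⊔y totalOrder x (- x)

  -x≤∣x∣ : ∀ x → - x ≤ ∣ x ∣
  -x≤∣x∣ x = Max.x≤y⊔x totalOrder x (- x)

  ∣x∣≤y : ∀ {x y} → x ≤ y → - x ≤ y → ∣ x ∣ ≤ y
  ∣x∣≤y = Max.⊔-lub totalOrder

  ∣x∣<y : ∀ {x y} → x < y → - x < y → ∣ x ∣ < y
  ∣x∣<y {x} x<y -x<y with Max.⊔-sel totalOrder x (- x)
  ... | inj₁ ∣x∣≈x  = ≤-<-trans (≤-reflexive ∣x∣≈x) x<y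
  ... | inj₂ ∣x∣≈-x = ≤-<-trans (≤-reflexive ∣x∣≈-x) -x<y

  -- Serves to bound `∣ γ ∣` by `∣ w i ∣`, with `n` the integer `m` or `- m`. Two one-sided
  -- hypotheses can be matched directly with `w i` and `- w i`, and the sign of `x` decides which of
  -- them is used.
  ∣x*n∣≤u⇒∣x∣≤u : ∀ {x n u} → 1# ≤ n → x * n ≤ u → - (x * n) ≤ u → ∣ x ∣ ≤ u
  ∣x*n∣≤u⇒∣x∣≤u {x} {n} {u} 1≤n xn≤u -xn≤u with total 0# x
  ... | inj₁ 0≤x = ∣x∣≤y x≤u (≤-trans (0≤x⇒-x≤0 0≤x) (≤-trans 0≤x x≤u))
    where
    x≤u : x ≤ u
    x≤u = begin
      x       ≈⟨ *-identityʳ x ⟨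
      x * 1#  ≤⟨ *-monoʳ-≤ 0≤x 1≤n ⟩
      x * n   ≤⟨ xn≤u ⟩
      u       ∎
  ... | inj₂ x≤0 = ∣x∣≤y (≤-trans x≤0 (≤-trans (x≤0⇒0≤-x x≤0) -x≤u)) -x≤u
    where
    -x≤u : - x ≤ u
    -x≤u = begin
      - x         ≈⟨ *-identityʳ (- x) ⟨
      - x * 1#    ≤⟨ *-monoʳ-≤ (x≤0⇒0≤-x x≤0) 1≤n ⟩
      - x * n     ≈⟨ -‿distribˡ-* x n ⟨
      - (x * n)   ≤⟨ -xn≤u ⟩
      u           ∎

  -- If q > 0 then u = q / (c + q) gives u * c < q.
  0≤u*c-q⇒q≤0 : ∀ {c q} → (∀ u → 0# < u → u ≤ 1# → 0# ≤ u * c - q) → q ≤ 0#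
  0≤u*c-q⇒q≤0 {c} {q} h with total q 0#
  ... | inj₁ q≤0 = q≤0
  ... | inj₂ 0≤q with q ≟ 0#
  ...   | yes q≈0 = ≤-reflexive q≈0
  ...   | no  q≉0 = contradiction (*-pos 0<u 0<q) λ 0<uq → <⇒≱ 0<uq
                      (0≤-x⇒x≤0 (≤-respʳ uc-q≈-uq (h u 0<u u≤1)))
    where
    0<q : 0# < q
    0<q = 0≤q , λ 0≈q → q≉0 (sym 0≈q)
    -- The case `u = 1#` of the hypothesis. It makes `c` nonnegative, so that `c + q` is positive
    -- and can be inverted.
    q≤c : q ≤ c
    q≤c = 0≤y-x⇒x≤y (≤-respʳ (+-congʳ (*-identityˡ c)) (h 1# 0<1 ≤-refl))
    0≤c : 0# ≤ c
    0≤c = ≤-trans 0≤q q≤c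
    0<c+q : 0# < c + q
    0<c+q = ≤-trans 0≤c (x≤x+y 0≤q) ,
      λ 0≈c+q → q≉0 (antisym (≤-trans q≤c (≤-respʳ (sym 0≈c+q) (x≤x+y 0≤q))) 0≤q)
    v = proj₁ (inverse (c + q) (<⇒≉0 0<c+q))
    [c+q]v≈1 : (c + q) * v ≈ 1#
    [c+q]v≈1 = proj₂ (inverse (c + q) (<⇒≉0 0<c+q))
    0<v : 0# < v
    0<v = inverse-pos 0<c+q [c+q]v≈1
    u = q * v
    0<u : 0# < u
    0<u = *-pos 0<q 0<v
    u≤1 : u ≤ 1#
    u≤1 = begin
      q * v          ≤⟨ x≤x+y (*-nonNeg 0≤c (proj₁ 0<v)) ⟩
      q * v + c * v  ≈⟨ solve 3 (λ c q v → q :* v :+ c :* v := (c :+ q) :* v) refl c q v ⟩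
      (c + q) * v    ≈⟨ [c+q]v≈1 ⟩
      1#             ∎
    q≈uc+uq : q ≈ u * c + u * q
    q≈uc+uq = begin-equality
      q                  ≈⟨ *-identityʳ q ⟨
      q * 1#             ≈⟨ *-congˡ [c+q]v≈1 ⟨
      q * ((c + q) * v)  ≈⟨ solve 3 (λ c q v → q :* ((c :+ q) :* v) := q :* v :* c :+ q :* v :* q) refl c q v ⟩
      u * c + u * q      ∎
    uc-q≈-uq : u * c - q ≈ - (u * q)
    uc-q≈-uq = begin-equality
      u * c - q                    ≈⟨ +-congˡ (-‿cong (trans q≈uc+uq (+-comm (u * c) (u * q)))) ⟩
      u * c - (u * q + u * c)      ≈⟨ +-congˡ (-‿anti-homo-+ (u * q) (u * c)) ⟩
      u * c + (- (u * c) - u * q)  ≈⟨ +-assoc _ _ _ ⟨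
      u * c - u * c - u * q        ≈⟨ +-congʳ (-‿inverseʳ (u * c)) ⟩
      0# - u * q                   ≈⟨ +-identityˡ _ ⟩
      - (u * q)                    ∎

  -- This is `∣ s ∣ ≤ δ` split into two inequalities, which negation of `s` exchanges.
  Within : Carrier → Carrier → Set ℓ₂
  Within δ s = s ≤ δ × - s ≤ δ

  Within-neg : ∀ {δ s} → Within δ s → Within δ (- s)
  Within-neg {_} {s} (s≤δ , -s≤δ) = -s≤δ , ≤-respˡ (sym (-‿involutive s)) s≤δ

  Within-nonNeg : ∀ {δ s} → 0# ≤ s → s ≤ δ → Within δ s
  Within-nonNeg 0≤s s≤δ = s≤δ , ≤-trans (0≤x⇒-x≤0 0≤s) (≤-trans 0≤s s≤δ)

  -- The two extreme values `s = δ` and `s = - δ` give the two signs of `a`.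
  linear-nonNeg⇒0 : ∀ {δ a} → 0# < δ → (∀ s → Within δ s → 0# ≤ s * a) → a ≈ 0#
  linear-nonNeg⇒0 {δ} {a} 0<δ h = antisym a≤0 0≤a
    where
    δ-within : Within δ δ
    δ-within = Within-nonNeg (proj₁ 0<δ) ≤-refl
    0≤a : 0# ≤ a
    0≤a = *-cancelˡ-nonNeg 0<δ (h δ δ-within)
    a≤0 : a ≤ 0#
    a≤0 = 0≤-x⇒x≤0 (*-cancelˡ-nonNeg 0<δ (≤-respʳ
      (trans (sym (-‿distribˡ-* δ a)) (-‿distribʳ-* δ a))
      (h (- δ) (Within-neg δ-within))))

  -- Adding the values at (s, t) and (- s, - t) removes the linear terms; what
  -- is left is t (t c + s q), and t is then made small compared to s = ± δ.
  mixed-coefficient≈0 : ∀ {δ a b c q} → 0# < δ →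
    (∀ s t → Within δ s → Within δ t →
      0# ≤ (t * b + t * t * c) + s * (a + t * q)) →
    q ≈ 0#
  mixed-coefficient≈0 {δ} {a} {b} {c} {q} 0<δ h = antisym q≤0 (≤-respʳ (-‿involutive q) (x≤0⇒0≤-x -q≤0))
    where
    even : ∀ s t → Within δ s → Within δ t → 0# ≤ t * (t * c + s * q)
    even s t hs ht = 0≤x+x⇒0≤x (begin
      0#
        ≈⟨ +-identityˡ 0# ⟨
      0# + 0#
        ≤⟨ +-mono-≤ (h s t hs ht) (h (- s) (- t) (Within-neg hs) (Within-neg ht)) ⟩
      ((t * b + t * t * c) + s * (a + t * q)) + ((- t * b + - t * - t * c) + - s * (a + - t * q))
        -- The regrouping is a semiring identity in which `- s` and `- t` are independent variables
        -- `s′` and `t′`. That they are negatives enters only in the next step, where the linear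
        -- terms cancel and the products of two signs agree.
        ≈⟨ solve 8 (λ s t s′ t′ a b c q →
             ((t :* b :+ t :* t :* c) :+ s :* (a :+ t :* q)) :+ ((t′ :* b :+ t′ :* t′ :* c) :+ s′ :* (a :+ t′ :* q))
             := ((t :* t :* c :+ t′ :* t′ :* c) :+ (s :* t :* q :+ s′ :* t′ :* q)) :+ ((t :+ t′) :* b :+ (s :+ s′) :* a))
             refl s t (- s) (- t) a b c q ⟩
      ((t * t * c + - t * - t * c) + (s * t * q + - s * - t * q)) + ((t - t) * b + (s - s) * a)
        ≈⟨ +-cong (+-cong (+-congˡ (*-congʳ (-x*-y≈x*y t t))) (+-congˡ (*-congʳ (-x*-y≈x*y s t))))
             (+-cong (trans (*-congʳ (-‿inverseʳ t)) (zeroˡ b)) (trans (*-congʳ (-‿inverseʳ s)) (zeroˡ a))) ⟩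
      ((t * t * c + t * t * c) + (s * t * q + s * t * q)) + (0# + 0#)
        ≈⟨ trans (+-congˡ (+-identityˡ 0#)) (+-identityʳ _) ⟩
      (t * t * c + t * t * c) + (s * t * q + s * t * q)
        ≈⟨ solve 4 (λ s t c q → (t :* t :* c :+ t :* t :* c) :+ (s :* t :* q :+ s :* t :* q)
             := t :* (t :* c :+ s :* q) :+ t :* (t :* c :+ s :* q)) refl s t c q ⟩
      t * (t * c + s * q) + t * (t * c + s * q)
        ∎)

    δ-within : Within δ δ
    δ-within = Within-nonNeg (proj₁ 0<δ) ≤-refl

    -- Take `t = δ * u` in `even` and cancel the positive factors `δ * u` and `δ`. The parameter `r`
    -- stands for `q` or `- q` according to the sign of `s`, so one argument covers both.
    scaled : ∀ s r → Within δ s → s * q ≈ δ * r →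
             ∀ u → 0# < u → u ≤ 1# → 0# ≤ u * c + r
    scaled s r hs sq≈δr u 0<u u≤1 = *-cancelˡ-nonNeg 0<δ (≤-respʳ
      (trans (+-congˡ sq≈δr)
        (solve 4 (λ δ u c r → δ :* u :* c :+ δ :* r := δ :* (u :* c :+ r)) refl δ u c r))
      (*-cancelˡ-nonNeg 0<δu (even s (δ * u) hs (Within-nonNeg (proj₁ 0<δu) δu≤δ))))
      where
      0<δu : 0# < δ * u
      0<δu = *-pos 0<δ 0<u
      δu≤δ : δ * u ≤ δ
      δu≤δ = ≤-respʳ (*-identityʳ δ) (*-monoʳ-≤ (proj₁ 0<δ) u≤1)

    q≤0 : q ≤ 0#
    q≤0 = 0≤u*c-q⇒q≤0 (scaled (- δ) (- q) (Within-neg δ-within)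
      (trans (sym (-‿distribˡ-* δ q)) (-‿distribʳ-* δ q)))

    -q≤0 : - q ≤ 0#
    -q≤0 = 0≤u*c-q⇒q≤0 (scaled δ (- - q) δ-within (*-congˡ (sym (-‿involutive q))))

-- Integers inside the field and the gap between 0 and 1.

module Integrality {c ℓ₁ ℓ₂} (ℝ : CompleteOrderedField c ℓ₁ ℓ₂) where
  open CompleteOrderedField ℝ
  open Optimization ℝ
  open CommutativeRing commutativeRing
    hiding (Carrier; _≈_; _+_; _*_; -_; 0#; 1#; _-_; +-rawMonoid; isCommutativeRing; zero)
  open DecTotalOrder decTotalOrder using (poset)
    renaming (refl to ≤-refl; trans to ≤-trans; ≤-respʳ-≈ to ≤-respʳ)
  open RingProperties ring using (+-cancelʳ; +-inverseʳ-unique)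
  open MonoidMult +-monoid using (×-homo-+) renaming (_×_ to _×ᴺ_)
  open SemiringSum semiring using (sum)
  open SemiringSolver commutativeSemiring using (solve; _:+_; _:*_; _:=_)
  open OrderedFieldProperties ℝ
  open import Relation.Binary.Reasoning.Setoid setoid

  -- An integer as a formal difference of naturals `m` and `n`: closure under addition then requires
  -- no case distinction on signs.
  Integral : Carrier → Set ℓ₁
  Integral x = ∃₂ λ m n → x + n ×ᴺ 1# ≈ m ×ᴺ 1#

  Integral-resp : ∀ {x y} → x ≈ y → Integral x → Integral y
  Integral-resp x≈y (m , n , eq) = m , n , trans (+-congʳ (sym x≈y)) eq

  Integral-0 : Integral 0#
  Integral-0 = 0 , 0 , +-identityˡ 0#

  Integral-+ : ∀ {x y} → Integral x → Integral y → Integral (x + y)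
  Integral-+ {x} {y} (m , n , eq) (m′ , n′ , eq′) = m ℕ.+ m′ , n ℕ.+ n′ , (begin
    x + y + (n ℕ.+ n′) ×ᴺ 1#          ≈⟨ +-congˡ (×-homo-+ 1# n n′) ⟩
    x + y + (n ×ᴺ 1# + n′ ×ᴺ 1#)      ≈⟨ solve 4 (λ x y a b → (x :+ y) :+ (a :+ b) := (x :+ a) :+ (y :+ b)) refl x y _ _ ⟩
    (x + n ×ᴺ 1#) + (y + n′ ×ᴺ 1#)    ≈⟨ +-cong eq eq′ ⟩
    m ×ᴺ 1# + m′ ×ᴺ 1#                ≈⟨ ×-homo-+ 1# m m′ ⟨
    (m ℕ.+ m′) ×ᴺ 1#                  ∎)

  Integral-fromℤ : ∀ k → Integral (fromℤ k)
  Integral-fromℤ (+ m)    = m , 0 , +-identityʳ _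
  Integral-fromℤ -[1+ n ] = 0 , ℕ.suc n , -‿inverseˡ _

  Integral-sum : ∀ {n} {xs : Vector Carrier n} → (∀ i → Integral (xs i)) → Integral (sum xs)
  Integral-sum {ℕ.zero}  h = Integral-0
  Integral-sum {ℕ.suc n} h = Integral-+ (h zero) (Integral-sum (h ∘ suc))

  0≤n×1 : ∀ n → 0# ≤ n ×ᴺ 1#
  0≤n×1 ℕ.zero    = ≤-refl
  0≤n×1 (ℕ.suc n) = ≤-trans 0≤1 (x≤x+y (0≤n×1 n))

  -- If `m` and `n` differ, the larger is the smaller plus `1 + k` for a natural `k`. Cancelling the
  -- smaller one leaves `1 + k` as the value of `x` or of `- x`.
  Integral⇒x≈0∨1≤∣x∣ : ∀ {x} → Integral x → x ≈ 0# ⊎ 1# ≤ x ⊎ 1# ≤ - x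
  Integral⇒x≈0∨1≤∣x∣ {x} (m , n , eq) with ℕ.compare m n
  ... | ℕ.equal _ = inj₁ (+-cancelʳ _ _ _ (trans eq (sym (+-identityˡ _))))
  ... | ℕ.less m k = inj₂ (inj₂ (≤-respʳ (+-inverseʳ-unique x _ (+-cancelʳ (m ×ᴺ 1#) _ _ (begin
    x + (1# + k ×ᴺ 1#) + m ×ᴺ 1#    ≈⟨ solve 4 (λ x o a b → (x :+ (o :+ b)) :+ a := x :+ (o :+ (a :+ b))) refl x 1# _ _ ⟩
    x + (1# + (m ×ᴺ 1# + k ×ᴺ 1#))  ≈⟨ +-congˡ (+-congˡ (×-homo-+ 1# m k)) ⟨
    x + ℕ.suc (m ℕ.+ k) ×ᴺ 1#       ≈⟨ eq ⟩
    m ×ᴺ 1#                         ≈⟨ +-identityˡ _ ⟨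
    0# + m ×ᴺ 1#                    ∎))) (x≤x+y (0≤n×1 k))))
  ... | ℕ.greater n k = inj₂ (inj₁ (≤-respʳ (+-cancelʳ (n ×ᴺ 1#) _ _ (begin
    (1# + k ×ᴺ 1#) + n ×ᴺ 1#        ≈⟨ solve 3 (λ o a b → (o :+ b) :+ a := o :+ (a :+ b)) refl 1# _ _ ⟩
    1# + (n ×ᴺ 1# + k ×ᴺ 1#)        ≈⟨ +-congˡ (×-homo-+ 1# n k) ⟨
    ℕ.suc (n ℕ.+ k) ×ᴺ 1#           ≈⟨ eq ⟨
    x + n ×ᴺ 1#                     ∎)) (x≤x+y (0≤n×1 k))))

-- Exact expansion of the objective when one coordinate moves.

module QuadraticObjective {c ℓ₁ ℓ₂} (ℝ : CompleteOrderedField c ℓ₁ ℓ₂) where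
  open CompleteOrderedField ℝ
  open Optimization ℝ
  open CommutativeRing commutativeRing
    hiding (Carrier; _≈_; _+_; _*_; -_; 0#; 1#; _-_; +-rawMonoid; isCommutativeRing; zero)
  open SemiringSum semiring using (sum; sum-cong-≋; *-distribʳ-sum; ∑-distrib-+)
  open SemiringSolver commutativeSemiring using (solve; _:+_; _:*_; _:=_)
  open Integrality ℝ
  open import Relation.Binary.Reasoning.Setoid setoid

  shift : ∀ {N} → Vector Carrier N → Fin N → Carrier → Vector Carrier N
  shift z i s = updateAt z i (_+ s)

  sum-shift : ∀ {N} (a z : Vector Carrier N) i s →
    sum (λ k → a k * shift z i s k) ≈ sum (λ k → a k * z k) + a i * s
  sum-shift {ℕ.suc N} a z zero s =
    solve 4 (λ a z s r → a :* (z :+ s) :+ r := a :* z :+ r :+ a :* s) refl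
      (a zero) (z zero) s (sum (λ k → a (suc k) * z (suc k)))
  sum-shift {ℕ.suc N} a z (suc i) s =
    trans (+-congˡ (sum-shift (a ∘ suc) (tail z) i s)) (sym (+-assoc _ _ _))

  -- Extension by zero below the diagonal turns the guarded double sum of `quadratic` into the full
  -- bilinear sum of a triangular matrix.
  upper : ∀ {N} → (Fin N → Fin N → ℤ) → Fin N → Fin N → Carrier
  upper Q k l = if does (k Fin.≤? l) then fromℤ (Q k l) else 0#

  Integral-upper : ∀ {N} (Q : Fin N → Fin N → ℤ) k l → Integral (upper Q k l)
  Integral-upper Q k l with does (k Fin.≤? l)
  ... | true  = Integral-fromℤ (Q k l)
  ... | false = Integral-0

  upper-diagonal : ∀ {N} (Q : Fin N → Fin N → ℤ) i → Q i i ≡ 0ℤ → upper Q i i ≈ 0#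
  upper-diagonal Q i Qii≡0 with does (i Fin.≤? i)
  ... | true  = reflexive (≡.cong fromℤ Qii≡0)
  ... | false = refl

  -- The Hessian of V: off the diagonal this is the coefficient of the product of two distinct
  -- variables, on the diagonal twice the coefficient of the square.
  mixed : ∀ {N} → (Fin N → Fin N → ℤ) → Fin N → Fin N → Carrier
  mixed Q i l = upper Q i l + upper Q l i

  module _ {N} (Q : Fin N → Fin N → ℤ) (d : Vector ℤ N) (const : Carrier) where

    private
      A : Fin N → Fin N → Carrier
      A = upper Q

    row : Vector Carrier N → Vector Carrier N
    row z k = sum (λ l → A k l * z l)

    quadratic-row : ∀ z → quadratic Q d const z ≈
      sum (λ k → row z k * z k) + sum (λ k → fromℤ (d k) * z k) + const
    quadratic-row z = +-congʳ (+-congʳ (sum-cong-≋ λ k →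
      trans (sum-cong-≋ (entry k)) (sym (*-distribʳ-sum (z k) (λ l → A k l * z l)))))
      where
      entry : ∀ k l →
        (if does (k Fin.≤? l) then fromℤ (Q k l) * (z k * z l) else 0#) ≈ A k l * z l * z k
      entry k l with does (k Fin.≤? l)
      ... | true  = solve 3 (λ q x y → q :* (x :* y) := q :* y :* x) refl _ (z k) (z l)
      ... | false = sym (trans (*-congʳ (zeroˡ _)) (zeroˡ _))

    ∂V : Fin N → Vector Carrier N → Carrier
    ∂V i z = sum (λ l → mixed Q i l * z l) + fromℤ (d i)

    -- The shift is carried out first in the inner factor `row`, then in the outer one. The linear
    -- terms are row `i` plus column `i` of the matrix; the term in `s * s` appears where both
    -- factors move, which is the entry `A i i`.
    sum-row-shift : ∀ z i s → sum (λ k → row (shift z i s) k * shift z i s k) ≈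
      sum (λ k → row z k * z k) + s * sum (λ l → mixed Q i l * z l) + s * s * A i i
    sum-row-shift z i s = begin
      sum (λ k → row z′ k * z′ k)
        ≈⟨ sum-cong-≋ (λ k → trans (*-congʳ (sum-shift (A k) z i s))
             (solve 4 (λ r a s x → (r :+ a :* s) :* x := r :* x :+ a :* x :* s) refl (row z k) (A k i) s (z′ k))) ⟩
      sum (λ k → row z k * z′ k + A k i * z′ k * s)
        ≈⟨ ∑-distrib-+ (λ k → row z k * z′ k) (λ k → A k i * z′ k * s) ⟩
      sum (λ k → row z k * z′ k) + sum (λ k → A k i * z′ k * s)
        ≈⟨ +-cong (sum-shift (row z) z i s)
             (trans (sym (*-distribʳ-sum s (λ k → A k i * z′ k))) (*-congʳ (sum-shift (λ k → A k i) z i s))) ⟩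
      (sum (λ k → row z k * z k) + row z i * s) + (column + A i i * s) * s
        ≈⟨ solve 5 (λ f r k a s → (f :+ r :* s) :+ (k :+ a :* s) :* s := f :+ s :* (r :+ k) :+ s :* s :* a)
             refl _ (row z i) column (A i i) s ⟩
      sum (λ k → row z k * z k) + s * (row z i + column) + s * s * A i i
        ≈⟨ +-congʳ (+-congˡ (*-congˡ (trans
             (sym (∑-distrib-+ (λ l → A i l * z l) (λ l → A l i * z l)))
             (sum-cong-≋ (λ l → sym (distribʳ (z l) (A i l) (A l i))))))) ⟩
      sum (λ k → row z k * z k) + s * sum (λ l → mixed Q i l * z l) + s * s * A i i
        ∎
      where
      z′ = shift z i s
      column = sum (λ k → A k i * z k)

    -- A second-order Taylor expansion, exact because V has degree at most two.
    quadratic-shift : ∀ z i s → quadratic Q d const (shift z i s) ≈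
      quadratic Q d const z + (s * ∂V i z + s * s * A i i)
    quadratic-shift z i s = begin
      quadratic Q d const z′
        ≈⟨ quadratic-row z′ ⟩
      sum (λ k → row z′ k * z′ k) + sum (λ k → fromℤ (d k) * z′ k) + const
        ≈⟨ +-congʳ (+-cong (sum-row-shift z i s) (sum-shift (fromℤ ∘ d) z i s)) ⟩
      (S + s * B + s * s * A i i) + (L + fromℤ (d i) * s) + const
        ≈⟨ solve 7 (λ S B L s a e k → (S :+ s :* B :+ s :* s :* a) :+ (L :+ e :* s) :+ k
                     := (S :+ L :+ k) :+ (s :* (B :+ e) :+ s :* s :* a))
             refl S B L s (A i i) (fromℤ (d i)) const ⟩
      (S + L + const) + (s * ∂V i z + s * s * A i i)
        ≈⟨ +-congʳ (quadratic-row z) ⟨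
      quadratic Q d const z + (s * ∂V i z + s * s * A i i)
        ∎
      where
      z′ = shift z i s
      S = sum (λ k → row z k * z k)
      L = sum (λ k → fromℤ (d k) * z k)
      B = sum (λ l → mixed Q i l * z l)

    module _ (w : Vector Carrier N) (γ : Carrier) where

      ∂f : Fin N → Vector Carrier N → Carrier
      ∂f i z = w i + γ * ∂V i z

      objective-shift : ∀ z i s →
        objective w γ (quadratic Q d const) (shift z i s) ≈
        objective w γ (quadratic Q d const) z + (s * ∂f i z + s * s * (γ * A i i))
      objective-shift z i s = trans
        (+-cong (sum-shift w z i s) (*-congˡ (quadratic-shift z i s)))
        (solve 7 (λ W V w s γ m a → (W :+ w :* s) :+ γ :* (V :+ (s :* m :+ s :* s :* a))
                    := (W :+ γ :* V) :+ (s :* (w :+ γ :* m) :+ s :* s :* (γ :* a)))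
           refl _ _ (w i) s γ (∂V i z) (A i i))

      -- The partial derivative is affine in `z`, so its change is linear in `t` with slope the
      -- Hessian entry.
      ∂f-shift : ∀ z i j t → ∂f i (shift z j t) ≈ ∂f i z + t * (γ * mixed Q i j)
      ∂f-shift z i j t = trans
        (+-congˡ (*-congˡ (+-congʳ (sum-shift (mixed Q i) z j t))))
        (solve 6 (λ w γ B b t e → w :+ γ :* ((B :+ b :* t) :+ e) := (w :+ γ :* (B :+ e)) :+ t :* (γ :* b))
           refl (w i) γ _ (mixed Q i j) t (fromℤ (d i)))

-- Fractional core coordinates at a local minimizer.

module FractionalCore {c ℓ₁ ℓ₂} (ℝ : CompleteOrderedField c ℓ₁ ℓ₂) where
  open CompleteOrderedField ℝ
  open Optimization ℝ
  open CommutativeRing commutativeRing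
    hiding (Carrier; _≈_; _+_; _*_; -_; 0#; 1#; _-_; +-rawMonoid; isCommutativeRing; zero)
  open DecTotalOrder decTotalOrder using (poset; antisym)
    renaming (refl to ≤-refl; reflexive to ≤-reflexive; trans to ≤-trans;
              ≤-respʳ-≈ to ≤-respʳ; ≤-respˡ-≈ to ≤-respˡ)
  open RingProperties ring
    using (-‿distribʳ-*; -‿involutive; -0#≈0#; +-inverseˡ-unique; +-inverseʳ-unique;
           //-rightDividesˡ; xyx⁻¹≈y)
  open OrderedFieldProperties ℝ
  open Integrality ℝ
  open QuadraticObjective ℝ
  open import Relation.Binary.Reasoning.PartialOrder poset

  ∣w∣≤maxCoreWeight : ∀ {N} (w : Vector Carrier N) i → Core w i → ∣ w i ∣ ≤ maxCoreWeight w
  ∣w∣≤maxCoreWeight w i i∈C = All.lookup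
    (Extrema.xs≤max totalOrder 0# _)
    (∈-map⁺ (λ k → ∣ w k ∣) (∈-filter⁺ (core? w) (∈-allFin i) i∈C))

  Fractional : Carrier → Set _
  Fractional x = 0# < x × x < 1#

  0∨1∨Fractional : ∀ {x} → 0# ≤ x × x ≤ 1# → x ≈ 0# ⊎ x ≈ 1# ⊎ Fractional x
  0∨1∨Fractional {x} (0≤x , x≤1) with x ≟ 0# | x ≟ 1#
  ... | yes x≈0 | _       = inj₁ x≈0
  ... | no _    | yes x≈1 = inj₂ (inj₁ x≈1)
  ... | no x≉0  | no x≉1  = inj₂ (inj₂ ((0≤x , x≉0 ∘ sym) , (x≤1 , x≉1)))

  -- The distance from `x` to each end of the unit interval is at least `δ`, so steps of size at
  -- most `δ` in either direction stay inside.
  Slack : Carrier → Carrier → Set ℓ₂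
  Slack x δ = δ ≤ x × δ ≤ 1# - x

  Slack-≤ : ∀ {x δ δ′} → δ′ ≤ δ → Slack x δ → Slack x δ′
  Slack-≤ δ′≤δ (l , u) = ≤-trans δ′≤δ l , ≤-trans δ′≤δ u

  Fractional⇒Slack : ∀ {x} → Fractional x → ∃ λ δ → 0# < δ × Slack x δ
  Fractional⇒Slack {x} (0<x , x≤1 , x≉1) =
    min-pos 0<x (x≤y⇒0≤y-x x≤1 , λ 0≈1-x →
      x≉1 (sym (trans (sym (//-rightDividesˡ x 1#))
        (trans (+-congʳ (sym 0≈1-x)) (+-identityˡ x)))))

  commonSlack : ∀ {x y ε} → 0# < ε → Fractional x → Fractional y →
    ∃ λ δ → 0# < δ × δ < ε × Slack x δ × Slack y δ
  commonSlack 0<ε fx fy =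
    let δ₁ , 0<δ₁ , δ₁<ε = positive-below 0<ε
        δ₂ , 0<δ₂ , sx = Fractional⇒Slack fx
        δ₃ , 0<δ₃ , sy = Fractional⇒Slack fy
        δ₄ , 0<δ₄ , δ₄≤δ₁ , δ₄≤δ₂ = min-pos 0<δ₁ 0<δ₂
        δ , 0<δ , δ≤δ₄ , δ≤δ₃ = min-pos 0<δ₄ 0<δ₃
    in δ , 0<δ , ≤-<-trans (≤-trans δ≤δ₄ δ₄≤δ₁) δ₁<ε ,
       Slack-≤ (≤-trans δ≤δ₄ δ₄≤δ₂) sx , Slack-≤ δ≤δ₃ sy

  module _ {N} (w : Vector Carrier N) (γ : Carrier)
    (Q : Fin N → Fin N → ℤ) (d : Vector ℤ N) (const : Carrier)
    (diagonal-free : ∀ i → Core w i → Q i i ≡ 0ℤ)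
    (max<∣γ∣ : maxCoreWeight w < ∣ γ ∣)
    (z : Vector Carrier N)
    (cube : Cube z) {ε} (0<ε : 0# < ε)
    (minimal : ∀ y → Cube y → Near ε z y →
      objective w γ (quadratic Q d const) z ≤ objective w γ (quadratic Q d const) y)
    where

    private
      f = objective w γ (quadratic Q d const)
      ∂ = λ i → ∂f Q d const w γ i
      m = λ i → ∂V Q d const i z
      B = mixed Q

    -- Both `Cube` and the sup-norm `Near` are conditions on single coordinates. With their
    -- conjunction stated per coordinate, a shift has to be checked only at the coordinate that it
    -- changes.
    Feasible : Fin N → Carrier → Set _
    Feasible k x = (0# ≤ x × x ≤ 1#) × ∣ x - z k ∣ < ε

    Feasible-z : ∀ k → Feasible k (z k)
    Feasible-z k = cube k , ∣x∣<y
      (≤-<-trans (≤-reflexive (-‿inverseʳ (z k))) 0<ε)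
      (≤-<-trans (0≤x⇒-x≤0 (≤-reflexive (sym (-‿inverseʳ (z k))))) 0<ε)

    Feasible-+ : ∀ {δ s} k → δ < ε → Slack (z k) δ → Within δ s → Feasible k (z k + s)
    Feasible-+ {δ} {s} k δ<ε (δ≤z , δ≤1-z) (s≤δ , -s≤δ) = (0≤z+s , z+s≤1) , ∣x∣<y
      (≤-<-trans (≤-respˡ (sym z+s-z≈s) s≤δ) δ<ε)
      (≤-<-trans (≤-respˡ (-‿cong (sym z+s-z≈s)) -s≤δ) δ<ε)
      where
      z+s-z≈s : z k + s - z k ≈ s
      z+s-z≈s = xyx⁻¹≈y (z k) s
      0≤z+s : 0# ≤ z k + s
      0≤z+s = ≤-respʳ (+-congˡ (-‿involutive s)) (x≤y⇒0≤y-x (≤-trans -s≤δ δ≤z))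
      z+s≤1 : z k + s ≤ 1#
      z+s≤1 = begin
        z k + s          ≤⟨ +-mono-≤ ≤-refl (≤-trans s≤δ δ≤1-z) ⟩
        z k + (1# - z k) ≈⟨ +-assoc _ _ _ ⟨
        z k + 1# - z k   ≈⟨ xyx⁻¹≈y (z k) 1# ⟩
        1#               ∎

    Feasible-shift : ∀ {y} i s → (∀ k → Feasible k (y k)) → Feasible i (y i + s) →
      ∀ k → Feasible k (shift y i s k)
    Feasible-shift {y} i s fy fi k = case k Fin.≟ i of λ where
      (yes ≡.refl) → ≡.subst (Feasible k) (≡.sym (updateAt-updates k y)) fi
      (no  k≢i)    → ≡.subst (Feasible k) (≡.sym (updateAt-minimal k i y k≢i)) (fy k)

    minimal′ : ∀ y → (∀ k → Feasible k (y k)) → f z ≤ f y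
    minimal′ y fy = minimal y (proj₁ ∘ fy) (proj₂ ∘ fy)

    -- Contradiction from one fractional core coordinate.

    module _ (i : Fin N) (i∈C : Core w i) (zᵢ-frac : Fractional (z i)) where

      Aii≈0 : upper Q i i ≈ 0#
      Aii≈0 = upper-diagonal Q i (diagonal-free i i∈C)

      -- The diagonal entry at a core index is zero, so `f` is affine in this coordinate. The base
      -- point `y` is arbitrary because another coordinate may have moved before.
      core-shift : ∀ y s → f (shift y i s) ≈ f y + s * ∂ i y
      core-shift y s = begin-equality
        f (shift y i s)
          ≈⟨ objective-shift Q d const w γ y i s ⟩
        f y + (s * ∂ i y + s * s * (γ * upper Q i i))
          ≈⟨ +-congˡ (+-congˡ (trans (*-congˡ (trans (*-congˡ Aii≈0) (zeroʳ γ))) (zeroʳ _))) ⟩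
        f y + (s * ∂ i y + 0#)
          ≈⟨ +-congˡ (+-identityʳ _) ⟩
        f y + s * ∂ i y
          ∎

      stationary : ∂ i z ≈ 0#
      stationary =
        -- Only coordinate `i` moves here, so it takes both places in `commonSlack`.
        let δ , 0<δ , δ<ε , slack , _ = commonSlack 0<ε zᵢ-frac zᵢ-frac
        in linear-nonNeg⇒0 0<δ λ s s-within →
          x≤x+y⇒0≤y (≤-respʳ (core-shift z s) (minimal′ (shift z i s)
            (Feasible-shift i s Feasible-z (Feasible-+ i δ<ε slack s-within))))

      wᵢ≈-γm : w i ≈ - (γ * m i)
      wᵢ≈-γm = +-inverseˡ-unique (w i) (γ * m i) stationary

      wᵢ≈γ[-m] : w i ≈ γ * - m i
      wᵢ≈γ[-m] = trans wᵢ≈-γm (-‿distribʳ-* γ (m i))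

      -wᵢ≈γm : - w i ≈ γ * m i
      -wᵢ≈γm = sym (+-inverseʳ-unique (w i) (γ * m i) stationary)

      ∣wᵢ∣<∣γ∣ : ∣ w i ∣ < ∣ γ ∣
      ∣wᵢ∣<∣γ∣ = ≤-<-trans (∣w∣≤maxCoreWeight w i i∈C) max<∣γ∣

      γm≉0 : ¬ γ * m i ≈ 0#
      γm≉0 γm≈0 = i∈C (trans wᵢ≈-γm (trans (-‿cong γm≈0) -0#≈0#))

      γ≉0 : ¬ γ ≈ 0#
      γ≉0 γ≈0 = γm≉0 (trans (*-congʳ γ≈0) (zeroˡ (m i)))

      -- Coordinate `j` moves first and may carry a quadratic term, since `j` can lie outside the
      -- core. Moving `i` afterwards is affine, with its slope taken at the point already shifted;
      -- the cross term comes from this slope.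
      increment-nonNeg : ∀ {δ j} → i ≢ j → δ < ε → Slack (z i) δ → Slack (z j) δ →
        ∀ s t → Within δ s → Within δ t →
        0# ≤ (t * ∂ j z + t * t * (γ * upper Q j j)) + s * (∂ i z + t * (γ * B i j))
      increment-nonNeg {_} {j} i≢j δ<ε slackᵢ slackⱼ s t s-within t-within = x≤x+y⇒0≤y (begin
        f z
          ≤⟨ minimal′ (shift zₜ i s) (Feasible-shift i s
               (Feasible-shift j t Feasible-z (Feasible-+ j δ<ε slackⱼ t-within))
               (≡.subst (λ x → Feasible i (x + s)) (≡.sym (updateAt-minimal i j z i≢j))
                 (Feasible-+ i δ<ε slackᵢ s-within))) ⟩
        f (shift zₜ i s)
          ≈⟨ core-shift zₜ s ⟩
        f zₜ + s * ∂ i zₜ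
          ≈⟨ +-cong (objective-shift Q d const w γ z j t) (*-congˡ (∂f-shift Q d const w γ z i j t)) ⟩
        f z + (t * ∂ j z + t * t * (γ * upper Q j j)) + s * (∂ i z + t * (γ * B i j))
          ≈⟨ +-assoc _ _ _ ⟩
        f z + ((t * ∂ j z + t * t * (γ * upper Q j j)) + s * (∂ i z + t * (γ * B i j)))
          ∎)
        where
        zₜ = shift z j t

      mixed≈0 : ∀ j → Fractional (z j) → B i j ≈ 0#
      mixed≈0 j zⱼ-frac = case i Fin.≟ j of λ where
        -- The diagonal Hessian entry is twice `upper Q i i`, which is zero on the core.
        (yes ≡.refl) → trans (+-cong Aii≈0 Aii≈0) (+-identityˡ 0#)
        (no  i≢j)    →
          let δ , 0<δ , δ<ε , slackᵢ , slackⱼ = commonSlack 0<ε zᵢ-frac zⱼ-frac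
          in x≉0⇒x*y≈0⇒y≈0 γ≉0
               (mixed-coefficient≈0 0<δ (increment-nonNeg i≢j δ<ε slackᵢ slackⱼ))

      Integral-∂V : Integral (m i)
      Integral-∂V = Integral-+ (Integral-sum summand) (Integral-fromℤ (d i))
        where
        summand : ∀ l → Integral (B i l * z l)
        summand l = case 0∨1∨Fractional (cube l) of λ where
          (inj₁ zₗ≈0)        → Integral-resp (sym (trans (*-congˡ zₗ≈0) (zeroʳ _))) Integral-0
          (inj₂ (inj₁ zₗ≈1)) → Integral-resp (sym (trans (*-congˡ zₗ≈1) (*-identityʳ _)))
            (Integral-+ (Integral-upper Q i l) (Integral-upper Q l i))
          -- The value `z l` may be any real in the open interval; the summand is an integer because
          -- its coefficient vanishes.
          (inj₂ (inj₂ frac)) → Integral-resp (sym (trans (*-congʳ (mixed≈0 l frac)) (zeroˡ _))) Integral-0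

      core-not-fractional : ⊥
      core-not-fractional = case Integral⇒x≈0∨1≤∣x∣ Integral-∂V of λ where
        (inj₁ m≈0)         → γm≉0 (trans (*-congˡ m≈0) (zeroʳ γ))
        -- Stationarity gives `γ * m i ≈ - w i`, so for `m i` the bounds on `- w i` and `w i` are
        -- used in this order. For `- m i` the product is `w i`, and their order is reversed.
        (inj₂ (inj₁ 1≤m))  → <⇒≱ ∣wᵢ∣<∣γ∣ (∣x*n∣≤u⇒∣x∣≤u 1≤m
          (≤-respˡ -wᵢ≈γm (-x≤∣x∣ (w i)))
          (≤-respˡ wᵢ≈-γm (x≤∣x∣ (w i))))
        (inj₂ (inj₂ 1≤-m)) → <⇒≱ ∣wᵢ∣<∣γ∣ (∣x*n∣≤u⇒∣x∣≤u 1≤-m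
          (≤-respˡ wᵢ≈γ[-m] (x≤∣x∣ (w i)))
          (≤-respˡ (-‿cong wᵢ≈γ[-m]) (-x≤∣x∣ (w i))))

theorem2p5 : ∀ {c ℓ₁ ℓ₂} (ℝ : CompleteOrderedField c ℓ₁ ℓ₂) →
    let open CompleteOrderedField ℝ
        open Optimization ℝ in
    (N : ℕ) → N ≥ 1 →
    (w : Vector Carrier N) (γ : Carrier)
    (Q : Fin N → Fin N → ℤ) (d : Vector ℤ N) (const : Carrier) →
    (∀ i → Core w i → Q i i ≡ 0ℤ) →
    maxCoreWeight w < ∣ γ ∣ →
    ∀ z* → LocalMinimizer (objective w γ (quadratic Q d const)) z* →
    ∀ i → Core w i → z* i ≈ 0# ⊎ z* i ≈ 1#
theorem2p5 ℝ N _ w γ Q d const diagonal-free max<∣γ∣ z* (cube , ε , 0<ε , minimal) i i∈C =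
  case 0∨1∨Fractional (cube i) of λ where
    (inj₁ z≈0)         → inj₁ z≈0
    (inj₂ (inj₁ z≈1))  → inj₂ z≈1
    (inj₂ (inj₂ frac)) → ⊥-elim (core-not-fractional w γ Q d const
      diagonal-free max<∣γ∣ z* cube 0<ε minimal i i∈C frac)
  where open FractionalCore ℝ
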